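{- Let $A\in\mathcal{PC}_{n}$ be a column perturbed consistent matrix. Then $\mathcal{C}(A)\subseteq\mathcal{E}(A)$; that is, every nonzero, nonnegative linear combination of the columns of $A$ is efficient for $A$.
   Context: An $n$-by-$n$ entrywise positive real matrix $A=[a_{ij}]$ is reciprocal if $a_{ji}=1/a_{ij}$ for all $1\le i,j\le n$ (so diagonal entries are $1$); $\mathcal{PC}_n$ denotes the set of such matrices. A matrix $A\in\mathcal{PC}_n$ is consistent if $a_{ik}=a_{ij}a_{jk}$ for all $i,j,k$ (equivalently $A=ww^{(-T)}$ for some positive vector $w$). Here, for an entrywise positive vector $w\in\mathbb{R}^n$, $w^{(-T)}$ is the row vector with entries $1/w_j$, so $ww^{(-T)}=[w_i/w_j]$. $A\in\mathcal{PC}_n$ is a column perturbed consistent matrix if it has a consistent $(n-1)$-by-$(n-1)$ principal submatrix, i.e., there is an index $k$ such that $a_{il}=a_{ij}a_{jl}$ for all $i,j,l\in\{1,\dots,n\}\setminus\{k\}$ (equivalently, $A$ is a reciprocal matrix obtained from a consistent matrix by modifying one column and the corresponding row). A positive vector $w\in\mathbb{R}^n$ is efficient for $A\in\mathcal{PC}_n$ if for every positive vector $v\in\mathbb{R}^n$, the entrywise inequality $|A-vv^{(-T)}|\le |A-ww^{(-T)}|$ (entrywise absolute values) implies that $v$ is proportional to $w$. $\mathcal{E}(A)$ denotes the set of all positive vectors efficient for $A$. $\mathcal{C}(A)$ denotes the convex cone generated by the columns of $A$, i.e., the set of nonzero, nonnegative linear combinations of the columns of $A$ (so $0\notin\mathcal{C}(A)$).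 -}

module Defs where

open import Algebra.Apartness.Bundles using (HeytingField; HeytingCommutativeRing)
open import Algebra.Bundles using (CommutativeRing)
import Algebra.Apartness.Properties.HeytingCommutativeRing as HeytingProperties
import Algebra.Properties.Monoid.Mult as Mult
import Algebra.Properties.Monoid.Sum as Sum
open import Data.Fin.Base using (Fin)
open import Data.Nat.Base using (ℕ) renaming (_≤_ to _≤ℕ_)
open import Data.Product.Base using (Σ-syntax; ∃-syntax; _×_; proj₁; proj₂)
open import Data.Sum.Base using (_⊎_)
open import Data.Vec.Functional using (Vector)
open import Level using (Level; suc) renaming (_⊔_ to _⊔ˡ_)
open import Relation.Binary.Core using (Rel)
open import Relation.Binary.Lattice.Definitions using (Supremum)
open import Relation.Binary.PropositionalEquality.Core using (_≢_)
open import Relation.Binary.Structures using (IsStrictPartialOrder)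
open import Relation.Nullary.Negation using (¬_)
open import Relation.Unary using (Pred)

-- The real numbers, axiomatised up to isomorphism as a Cauchy-complete
-- Archimedean ordered field.  The order axioms are the usual constructive ones,
-- so that the Bishop reals are a model as well as any classical presentation:
-- x # y ("x < y or y < x") is the positive form of x ≉ y, and under excluded
-- middle the two coincide and _<_ is a trichotomous order.

record RealNumbers (c ℓ₁ ℓ₂ : Level) : Set (suc (c ⊔ˡ ℓ₁ ⊔ˡ ℓ₂)) where
  field
    heytingField : HeytingField c ℓ₁ ℓ₂

  open HeytingField heytingField public
  open HeytingCommutativeRing heytingCommutativeRing public using (commutativeRing)
  open CommutativeRing commutativeRing public using (+-monoid)
  open Mult +-monoid using () renaming (_×_ to _×ℕ_)

  infix 4 _<_ _≤_
  infixl 5 _⊔_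

  field
    _<_                  : Rel Carrier ℓ₂
    isStrictPartialOrder : IsStrictPartialOrder _≈_ _<_
    #⇒<⊎>                : ∀ {x y} → x # y → x < y ⊎ y < x
    <⇒#                  : ∀ {x y} → x < y → x # y
    +-monoʳ-<            : ∀ z {x y} → x < y → z + x < z + y
    *-pos                : ∀ {x y} → 0# < x → 0# < y → 0# < x * y

  _≤_ : Rel Carrier ℓ₂
  x ≤ y = ¬ (y < x)

  field
    _⊔_        : Carrier → Carrier → Carrier
    ⊔-supremum : Supremum _≤_ _⊔_

  ∣_∣ : Carrier → Carrier
  ∣ x ∣ = x ⊔ (- x)

  IsCauchy : (ℕ → Carrier) → Set (c ⊔ˡ ℓ₂)
  IsCauchy s = ∀ ε → 0# < ε →
    ∃[ N ] (∀ m n → N ≤ℕ m → N ≤ℕ n → ∣ s m - s n ∣ ≤ ε)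

  _ConvergesTo_ : (ℕ → Carrier) → Carrier → Set (c ⊔ˡ ℓ₂)
  s ConvergesTo x = ∀ ε → 0# < ε →
    ∃[ N ] (∀ n → N ≤ℕ n → ∣ s n - x ∣ ≤ ε)

  field
    archimedean : ∀ x → ∃[ n ] (x < n ×ℕ 1#)
    complete    : ∀ s → IsCauchy s → ∃[ x ] (s ConvergesTo x)

  -- The library's #⇒invertible inverts x - y, and x - 0# is only ≈ to x;
  -- recip-inverse below confirms that this is an inverse of x itself.
  recip : ∀ x → 0# < x → Carrier
  recip x 0<x = proj₁ (#⇒invertible (#-sym (<⇒# 0<x)))

  recip-inverse : ∀ x (0<x : 0# < x) → x * recip x 0<x ≈ 1#
  recip-inverse x 0<x =
    trans (*-congʳ (sym (x-0≈x x)))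
          (proj₂ (proj₂ (#⇒invertible (#-sym (<⇒# 0<x)))))
    where open HeytingProperties heytingCommutativeRing using (x-0≈x)

module PairwiseComparison {c ℓ₁ ℓ₂} (ℝ : RealNumbers c ℓ₁ ℓ₂) where
  open RealNumbers ℝ
  open Sum +-monoid using (sum-syntax)

  Matrix : ℕ → Set c
  Matrix n = Vector (Vector Carrier n) n

  Positive : ∀ {n} → Vector Carrier n → Set ℓ₂
  Positive w = ∀ i → 0# < w i

  -- w w^(-T) = [wᵢ / wⱼ]
  ratios : ∀ {n} (w : Vector Carrier n) → Positive w → Matrix n
  ratios w w>0 i j = w i * recip (w j) (w>0 j)

  record IsReciprocal {n} (A : Matrix n) : Set (ℓ₁ ⊔ˡ ℓ₂) where
    field
      positive   : ∀ i j → 0# < A i j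
      reciprocal : ∀ i j → A j i ≈ recip (A i j) (positive i j)

  𝒫𝒞 : ∀ n → Pred (Matrix n) (ℓ₁ ⊔ˡ ℓ₂)
  𝒫𝒞 n = IsReciprocal

  IsColumnPerturbedConsistent : ∀ {n} → Matrix n → Set ℓ₁
  IsColumnPerturbedConsistent A =
    ∃[ k ] (∀ i j l → i ≢ k → j ≢ k → l ≢ k → A i l ≈ A i j * A j l)

  _∝_ : ∀ {n} → Vector Carrier n → Vector Carrier n → Set (c ⊔ˡ ℓ₁)
  v ∝ w = ∃[ t ] (∀ i → v i ≈ t * w i)

  ℰ : ∀ {n} → Matrix n → Pred (Vector Carrier n) (c ⊔ˡ ℓ₁ ⊔ˡ ℓ₂)
  ℰ A w = Σ[ w>0 ∈ Positive w ]
    (∀ v (v>0 : Positive v) →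
      (∀ i j → ∣ A i j - ratios v v>0 i j ∣ ≤ ∣ A i j - ratios w w>0 i j ∣) →
      v ∝ w)

  -- A vector is nonzero when some entry is apart from 0#.
  𝒞 : ∀ {n} → Matrix n → Pred (Vector Carrier n) (c ⊔ˡ ℓ₁ ⊔ˡ ℓ₂)
  𝒞 {n} A w =
    (∃[ i ] (w i # 0#)) ×
    (Σ[ x ∈ Vector Carrier n ]
      ((∀ j → 0# ≤ x j) ×
       (∀ i → w i ≈ ∑[ j < n ] (x j * A i j))))

{-# OPTIONS --safe #-}

-- Draw an arc i ⟶ j when row i of A dominates aᵢⱼ times row j.  For w in the
-- cone of the columns an arc forces wᵢ / wⱼ ≥ aᵢⱼ, and if v approximates A at
-- least as well as w does then vᵢ / wᵢ ≤ vⱼ / wⱼ.  So v ∝ w as soon as the arcs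
-- strongly connect the indices.  Let k be the perturbed index; the consistent
-- block is [uᵢ / uⱼ].  Ordering i ≢ k by bᵢ = aᵢₖ / uᵢ gives i ⟶ j whenever
-- bⱼ ≤ bᵢ, together with arcs from the minimum to k and from k to the maximum.
-- Constructively the extrema need not exist, but the conclusion is a negation,
-- so one can instead induct along the strict order of the bᵢ, which is
-- well-founded since there are finitely many indices.

module Submission where

open import Algebra.Bundles using (CommutativeRing)
import Algebra.Properties.AbelianGroup as AbelianGroupProperties
import Algebra.Properties.Semiring.Sum as SemiringSum
import Algebra.Solver.Ring.NaturalCoefficients.Default as Solver
open import Data.Empty using (⊥-elim)
open import Data.Fin.Base using (Fin; zero; suc)
open import Data.Fin.Induction using (spo-wellFounded; spo-noetherian)
open import Data.Fin.Properties using (_≟_)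
open import Data.Nat.Base using (ℕ; zero; suc)
open import Data.Product.Base using (∃-syntax; _,_; proj₁; proj₂)
open import Data.Sum.Base using (_⊎_; inj₁; inj₂)
open import Data.Vec.Functional using (Vector)
open import Function.Base using (_∘_; _on_; flip)
open import Induction.WellFounded using (Acc; acc)
open import Level using (Level)
import Relation.Binary.Construct.On as On
open import Relation.Binary.PropositionalEquality.Core using (_≢_)
  renaming (refl to ≡-refl)
import Relation.Binary.Reasoning.Base.Triple as TripleReasoning
open import Relation.Binary.Structures using (IsPreorder; IsStrictPartialOrder)
open import Relation.Nullary.Decidable.Core using (yes; no)
open import Relation.Nullary.Negation.Core using (¬_)
open import Relation.Unary using (_∈_; _⊆_)
open import Defs

-- Constructive arithmetic of ordered fields.

module OrderedField {c ℓ₁ ℓ₂} (ℝ : RealNumbers c ℓ₁ ℓ₂) where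
  open RealNumbers ℝ hiding (zero)
  open CommutativeRing commutativeRing
    using (semiring; commutativeSemiring; +-abelianGroup)
  open IsStrictPartialOrder isStrictPartialOrder public
    using (<-respˡ-≈; <-respʳ-≈; <-resp-≈)
    renaming (irrefl to <-irrefl; trans to <-trans; asym to <-asym)
  open AbelianGroupProperties +-abelianGroup using (⁻¹-anti-homo‿-)
  open SemiringSum semiring using (sum)
  open Solver commutativeSemiring public using (solve; _:=_; _:*_)

  private variable
    x y z : Carrier

  <-cotrans : x < y → ∀ z → x < z ⊎ z < y
  <-cotrans x<y z with #-cotrans (<⇒# x<y) z
  ... | inj₁ x#z with #⇒<⊎> x#z
  ...   | inj₁ x<z = inj₁ x<z
  ...   | inj₂ z<x = inj₂ (<-trans z<x x<y)
  <-cotrans x<y z | inj₂ z#y with #⇒<⊎> z#y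
  ...   | inj₁ z<y = inj₂ z<y
  ...   | inj₂ y<z = inj₁ (<-trans x<y y<z)

  <⇒≤ : x < y → x ≤ y
  <⇒≤ = <-asym

  ≤-reflexive : x ≈ y → x ≤ y
  ≤-reflexive x≈y = <-irrefl (sym x≈y)

  ≤-trans : x ≤ y → y ≤ z → x ≤ z
  ≤-trans {y = y} x≤y y≤z z<x with <-cotrans z<x y
  ... | inj₁ z<y = y≤z z<y
  ... | inj₂ y<x = x≤y y<x

  <-≤-trans : x < y → y ≤ z → x < z
  <-≤-trans {z = z} x<y y≤z with <-cotrans x<y z
  ... | inj₁ x<z = x<z
  ... | inj₂ z<y = ⊥-elim (y≤z z<y)

  ≤-<-trans : x ≤ y → y < z → x < z
  ≤-<-trans {x = x} x≤y y<z with <-cotrans y<z x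
  ... | inj₁ y<x = ⊥-elim (x≤y y<x)
  ... | inj₂ x<z = x<z

  ≤-antisym : x ≤ y → y ≤ x → x ≈ y
  ≤-antisym {x} {y} x≤y y≤x = proj₁ (tight x y) λ x#y → case (#⇒<⊎> x#y)
    where
    case : ¬ (x < y ⊎ y < x)
    case (inj₁ x<y) = y≤x x<y
    case (inj₂ y<x) = x≤y y<x

  ≤-isPreorder : IsPreorder _≈_ _≤_
  ≤-isPreorder = record
    { isEquivalence = isEquivalence
    ; reflexive     = ≤-reflexive
    ; trans         = ≤-trans
    }

  module ≤-Reasoning = TripleReasoning
    ≤-isPreorder <-asym <-trans <-resp-≈ <⇒≤ <-≤-trans ≤-<-trans

  open ≤-Reasoning

  +-cancelˡ-< : ∀ z → z + x < z + y → x < y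
  +-cancelˡ-< {x} {y} z z+x<z+y = begin-strict
    x              ≈⟨ cancel x ⟨
    - z + (z + x)  <⟨ +-monoʳ-< (- z) z+x<z+y ⟩
    - z + (z + y)  ≈⟨ cancel y ⟩
    y              ∎
    where
    cancel : ∀ u → - z + (z + u) ≈ u
    cancel u = trans (sym (+-assoc _ _ _))
      (trans (+-congʳ (-‿inverseˡ z)) (+-identityˡ u))

  +-monoʳ-≤ : ∀ z → x ≤ y → z + x ≤ z + y
  +-monoʳ-≤ z x≤y = x≤y ∘ +-cancelˡ-< z

  +-mono-≤ : ∀ {u} → x ≤ y → z ≤ u → x + z ≤ y + u
  +-mono-≤ {x} {y} {z} {u} x≤y z≤u = begin
    x + z  ≤⟨ +-monoʳ-≤ x z≤u ⟩
    x + u  ≈⟨ +-comm x u ⟩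
    u + x  ≤⟨ +-monoʳ-≤ u x≤y ⟩
    u + y  ≈⟨ +-comm u y ⟩
    y + u  ∎

  *-monoʳ-< : 0# < z → x < y → z * x < z * y
  *-monoʳ-< {z} {x} {y} 0<z x<y = begin-strict
    z * x                    ≈⟨ +-identityʳ _ ⟨
    z * x + 0#               <⟨ +-monoʳ-< _ (*-pos 0<z 0<y-x) ⟩
    z * x + z * (- x + y)    ≈⟨ distribˡ z x _ ⟨
    z * (x + (- x + y))      ≈⟨ *-congˡ (+-assoc x (- x) y) ⟨
    z * (x + - x + y)        ≈⟨ *-congˡ (+-congʳ (-‿inverseʳ x)) ⟩
    z * (0# + y)             ≈⟨ *-congˡ (+-identityˡ y) ⟩
    z * y                    ∎
    where
    0<y-x : 0# < - x + y
    0<y-x = <-respˡ-≈ (-‿inverseˡ x) (+-monoʳ-< (- x) x<y)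

  *-cancelˡ-≤ : 0# < z → z * x ≤ z * y → x ≤ y
  *-cancelˡ-≤ 0<z zx≤zy = zx≤zy ∘ *-monoʳ-< 0<z

  -- `x ≤ y` cannot be split into `x < y` or `x ≈ y`. But if `z * y < z * x`, strict monotonicity
  -- refutes `x < y`, so `x ≈ y` by antisymmetry, a contradiction.
  *-monoʳ-≤ : 0# < z → x ≤ y → z * x ≤ z * y
  *-monoʳ-≤ 0<z x≤y zy<zx = <-irrefl (*-congˡ (sym x≈y)) zy<zx
    where
    x≈y = ≤-antisym x≤y λ x<y → <-asym zy<zx (*-monoʳ-< 0<z x<y)

  *-nonNeg : 0# < z → 0# ≤ x → 0# ≤ z * x
  *-nonNeg {z} 0<z 0≤x = ≤-trans (≤-reflexive (sym (zeroʳ z))) (*-monoʳ-≤ 0<z 0≤x)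

  -- Under the negated conclusion `0# < z` is impossible, so `z ≈ 0#` and both products vanish.
  *-monoʳ-≤-nonNeg : 0# ≤ z → x ≤ y → z * x ≤ z * y
  *-monoʳ-≤-nonNeg {z} {x} {y} 0≤z x≤y zy<zx = ≤-reflexive zx≈zy zy<zx
    where
    z≈0 : z ≈ 0#
    z≈0 = sym (≤-antisym 0≤z λ 0<z → *-monoʳ-≤ 0<z x≤y zy<zx)
    zx≈zy : z * x ≈ z * y
    zx≈zy = trans (trans (*-congʳ z≈0) (zeroˡ x))
              (sym (trans (*-congʳ z≈0) (zeroˡ y)))

  x*x≈1⇒x≈1 : 0# < x → x * x ≈ 1# → x ≈ 1#
  x*x≈1⇒x≈1 {x} 0<x x*x≈1 = ≤-antisym
    (λ 1<x → <-irrefl (sym x*x≈1) (<-trans 1<x (x1<xx 1<x)))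
    (λ x<1 → <-irrefl x*x≈1 (<-trans (xx<x1 x<1) x<1))
    where
    x1<xx : 1# < x → x < x * x
    x1<xx = <-respˡ-≈ (*-identityʳ x) ∘ *-monoʳ-< 0<x
    xx<x1 : x < 1# → x * x < x
    xx<x1 = <-respʳ-≈ (*-identityʳ x) ∘ *-monoʳ-< 0<x

  -- Since `a ≤ p`, the right-hand distance is exactly `p - a`, while `q - a` never exceeds
  -- `∣ a - q ∣`.
  ∣a-q∣≤∣a-p∣⇒q≤p : ∀ {a p q} → a ≤ p → ∣ a - q ∣ ≤ ∣ a - p ∣ → q ≤ p
  ∣a-q∣≤∣a-p∣⇒q≤p {a} {p} {q} a≤p closer p<q = -a+q≤-a+p (+-monoʳ-< (- a) p<q)
    where
    a-p≤0 : a - p ≤ 0#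
    a-p≤0 = begin
      a - p    ≈⟨ +-comm a (- p) ⟩
      - p + a  ≤⟨ +-monoʳ-≤ (- p) a≤p ⟩
      - p + p  ≈⟨ -‿inverseˡ p ⟩
      0#       ∎
    0≤-a+p : 0# ≤ - a + p
    0≤-a+p = begin
      0#       ≈⟨ -‿inverseˡ a ⟨
      - a + a  ≤⟨ +-monoʳ-≤ (- a) a≤p ⟩
      - a + p  ∎
    -[a-_] : ∀ u → - (a - u) ≈ - a + u
    -[a- u ] = trans (⁻¹-anti-homo‿- a u) (+-comm u (- a))
    -a+q≤-a+p : - a + q ≤ - a + p
    -a+q≤-a+p = begin
      - a + q      ≈⟨ -[a- q ] ⟨
      - (a - q)    ≤⟨ proj₁ (proj₂ (⊔-supremum (a - q) (- (a - q)))) ⟩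
      ∣ a - q ∣    ≤⟨ closer ⟩
      ∣ a - p ∣    ≤⟨ proj₂ (proj₂ (⊔-supremum (a - p) (- (a - p)))) _
                       (≤-trans a-p≤0 0≤-a+p) (≤-reflexive -[a- p ]) ⟩
      - a + p      ∎

  sum-mono-≤ : ∀ {n} (f g : Vector Carrier n) → (∀ i → f i ≤ g i) → sum f ≤ sum g
  sum-mono-≤ {zero}  f g f≤g = ≤-reflexive refl
  sum-mono-≤ {suc n} f g f≤g =
    +-mono-≤ (f≤g zero) (sum-mono-≤ (f ∘ suc) (g ∘ suc) (f≤g ∘ suc))

  sum-nonNeg : ∀ {n} (f : Vector Carrier n) → (∀ i → 0# ≤ f i) → 0# ≤ sum f
  sum-nonNeg {zero}  f 0≤f = ≤-reflexive refl
  sum-nonNeg {suc n} f 0≤f = ≤-trans (≤-reflexive (sym (+-identityʳ 0#)))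
    (+-mono-≤ (0≤f zero) (sum-nonNeg (f ∘ suc) (0≤f ∘ suc)))

  term≤sum : ∀ {n} (f : Vector Carrier n) → (∀ i → 0# ≤ f i) → ∀ i → f i ≤ sum f
  term≤sum f 0≤f zero = ≤-trans (≤-reflexive (sym (+-identityʳ _)))
    (+-monoʳ-≤ (f zero) (sum-nonNeg (f ∘ suc) (0≤f ∘ suc)))
  term≤sum f 0≤f (suc i) = ≤-trans (≤-reflexive (sym (+-identityˡ _)))
    (+-mono-≤ (0≤f zero) (term≤sum (f ∘ suc) (0≤f ∘ suc) i))

  -- Cotransitivity at the head term yields either a positive head or a positive tail sum, so the
  -- index is found without deciding signs.
  0<sum⇒0<term : ∀ {n} (f : Vector Carrier n) → 0# < sum f → ∃[ i ] (0# < f i)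
  0<sum⇒0<term {zero}  f 0<0 = ⊥-elim (<-irrefl refl 0<0)
  0<sum⇒0<term {suc n} f 0<∑ with <-cotrans 0<∑ (f zero)
  ... | inj₁ 0<f₀ = zero , 0<f₀
  ... | inj₂ f₀<∑ =
    let i , 0<fᵢ = 0<sum⇒0<term (f ∘ suc)
          (+-cancelˡ-< (f zero) (<-respˡ-≈ (sym (+-identityʳ _)) f₀<∑))
    in suc i , 0<fᵢ

-- Reciprocal matrices, arcs and the cone of columns.

module ReciprocalMatrix {c ℓ₁ ℓ₂} (ℝ : RealNumbers c ℓ₁ ℓ₂) where
  open RealNumbers ℝ
  open PairwiseComparison ℝ
  open OrderedField ℝ
  open ≤-Reasoning
  open CommutativeRing commutativeRing using (semiring)
  open SemiringSum semiring using (sum-syntax; *-distribˡ-sum)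

  module _ {n} {A : Matrix n} (A∈𝒫𝒞 : A ∈ 𝒫𝒞 n) where
    open IsReciprocal A∈𝒫𝒞

    aᵢⱼ*aⱼᵢ≈1 : ∀ i j → A i j * A j i ≈ 1#
    aᵢⱼ*aⱼᵢ≈1 i j = trans (*-congˡ (reciprocal i j)) (recip-inverse _ (positive i j))

    aᵢᵢ≈1 : ∀ i → A i i ≈ 1#
    aᵢᵢ≈1 i = x*x≈1⇒x≈1 (positive i i) (aᵢⱼ*aⱼᵢ≈1 i i)

    infix 4 _⟶_

    _⟶_ : Fin n → Fin n → Set ℓ₂
    i ⟶ j = ∀ l → A i j * A j l ≤ A i l

    module _ {w : Vector Carrier n} {x : Vector Carrier n} (0≤x : ∀ j → 0# ≤ x j)
             (w≈ : ∀ i → w i ≈ ∑[ j < n ] (x j * A i j)) where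

      private
        0≤xA : ∀ i j → 0# ≤ x j * A i j
        0≤xA i j = ≤-trans (*-nonNeg (positive i j) (0≤x j)) (≤-reflexive (*-comm _ _))

      cone-positive : ∃[ i ] (w i # 0#) → Positive w
      cone-positive (i , wᵢ#0) l with #⇒<⊎> wᵢ#0
      ... | inj₁ wᵢ<0 = ⊥-elim (sum-nonNeg _ (0≤xA i) (<-respˡ-≈ (w≈ i) wᵢ<0))
      ... | inj₂ 0<wᵢ = let j , 0<xⱼaᵢⱼ = 0<sum⇒0<term _ (<-respʳ-≈ (w≈ i) 0<wᵢ) in
        begin-strict
        -- The factor `A j i` cancels `A i j`, which carries the positive term of row `i` over to
        -- row `l`.
        0#                            <⟨ *-pos (*-pos 0<xⱼaᵢⱼ (positive j i)) (positive l j) ⟩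
        x j * A i j * A j i * A l j   ≈⟨ *-congʳ (*-assoc _ _ _) ⟩
        x j * (A i j * A j i) * A l j ≈⟨ *-congʳ (*-congˡ (aᵢⱼ*aⱼᵢ≈1 i j)) ⟩
        x j * 1# * A l j              ≈⟨ *-congʳ (*-identityʳ _) ⟩
        x j * A l j                   ≤⟨ term≤sum _ (0≤xA l) j ⟩
        ∑[ j < n ] (x j * A l j)      ≈⟨ w≈ l ⟨
        w l                           ∎

      ⟶⇒aᵢⱼwⱼ≤wᵢ : ∀ {i j} → i ⟶ j → A i j * w j ≤ w i
      ⟶⇒aᵢⱼwⱼ≤wᵢ {i} {j} i⟶j = begin
        A i j * w j                           ≈⟨ *-congˡ (w≈ j) ⟩
        A i j * ∑[ l < n ] (x l * A j l)      ≈⟨ *-distribˡ-sum (A i j) (λ l → x l * A j l) ⟩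
        ∑[ l < n ] (A i j * (x l * A j l))    ≤⟨ sum-mono-≤ _ _ termwise ⟩
        ∑[ l < n ] (x l * A i l)              ≈⟨ w≈ i ⟨
        w i                                   ∎
        where
        termwise : ∀ l → A i j * (x l * A j l) ≤ x l * A i l
        termwise l = begin
          A i j * (x l * A j l)  ≈⟨ solve 3 (λ a b c → a :* (b :* c) := b :* (a :* c))
                                          refl (A i j) (x l) (A j l) ⟩
          x l * (A i j * A j l)  ≤⟨ *-monoʳ-≤-nonNeg (0≤x l) (i⟶j l) ⟩
          x l * A i l            ∎

    -- Arcs of a column perturbed consistent matrix.

    module _ {k} (consistent : ∀ i j l → i ≢ k → j ≢ k → l ≢ k → A i l ≈ A i j * A j l)
             {p} (p≢k : p ≢ k) where

      -- bᵢ = aᵢₖ / uᵢ for the normalisation uᵢ = aᵢₚ of the consistent block.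
      b : Fin n → Carrier
      b i = A p i * A i k

      bⱼ≤bᵢ⇒aᵢⱼaⱼₖ≤aᵢₖ : ∀ {i j} → i ≢ k → j ≢ k → b j ≤ b i → A i j * A j k ≤ A i k
      bⱼ≤bᵢ⇒aᵢⱼaⱼₖ≤aᵢₖ {i} {j} i≢k j≢k bⱼ≤bᵢ = *-cancelˡ-≤ (positive p i) (begin
        A p i * (A i j * A j k)  ≈⟨ *-assoc _ _ _ ⟨
        A p i * A i j * A j k    ≈⟨ *-congʳ (consistent p i j p≢k i≢k j≢k) ⟨
        A p j * A j k            ≤⟨ bⱼ≤bᵢ ⟩
        A p i * A i k            ∎)

      -- In columns other than `k` consistency makes domination an equality; column `k` is where the
      -- order of `b` enters.
      bⱼ≤bᵢ⇒i⟶j : ∀ {i j} → i ≢ k → j ≢ k → b j ≤ b i → i ⟶ j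
      bⱼ≤bᵢ⇒i⟶j {i} {j} i≢k j≢k bⱼ≤bᵢ l with l ≟ k
      ... | yes ≡-refl = bⱼ≤bᵢ⇒aᵢⱼaⱼₖ≤aᵢₖ i≢k j≢k bⱼ≤bᵢ
      ... | no  l≢k    = ≤-reflexive (sym (consistent i j l i≢k j≢k l≢k))

      -- For `l ≢ k`, reciprocity turns the required `A i k * A k l ≤ A i l` into
      -- `A l i * A i k ≤ A l k`, which follows from `b i ≤ b l`.
      minimum⟶k : ∀ {i} → i ≢ k → (∀ l → l ≢ k → b i ≤ b l) → i ⟶ k
      minimum⟶k {i} i≢k minimal l with l ≟ k
      ... | yes ≡-refl = ≤-reflexive (trans (*-congˡ (aᵢᵢ≈1 k)) (*-identityʳ _))
      ... | no  l≢k    = begin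
        A i k * A k l                          ≈⟨ *-identityˡ _ ⟨
        1# * (A i k * A k l)                   ≈⟨ *-congʳ (aᵢⱼ*aⱼᵢ≈1 i l) ⟨
        A i l * A l i * (A i k * A k l)        ≈⟨ solve 4 (λ a b c d → a :* b :* (c :* d) := a :* d :* (b :* c))
                                                        refl (A i l) (A l i) (A i k) (A k l) ⟩
        A i l * A k l * (A l i * A i k)        ≤⟨ *-monoʳ-≤ (*-pos (positive i l) (positive k l))
                                                    (bⱼ≤bᵢ⇒aᵢⱼaⱼₖ≤aᵢₖ l≢k i≢k (minimal l l≢k)) ⟩
        A i l * A k l * A l k                  ≈⟨ *-assoc _ _ _ ⟩
        A i l * (A k l * A l k)                ≈⟨ *-congˡ (aᵢⱼ*aⱼᵢ≈1 k l) ⟩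
        A i l * 1#                             ≈⟨ *-identityʳ _ ⟩
        A i l                                  ∎

      -- Dually, `A k i * A i l ≤ A k l` is equivalent to `A i l * A l k ≤ A i k`, which follows
      -- from `b l ≤ b i`.
      k⟶maximum : ∀ {i} → i ≢ k → (∀ l → l ≢ k → b l ≤ b i) → k ⟶ i
      k⟶maximum {i} i≢k maximal l with l ≟ k
      ... | yes ≡-refl = ≤-reflexive (trans (aᵢⱼ*aⱼᵢ≈1 k i) (sym (aᵢᵢ≈1 k)))
      ... | no  l≢k    = begin
        A k i * A i l                          ≈⟨ *-identityʳ _ ⟨
        A k i * A i l * 1#                     ≈⟨ *-congˡ (aᵢⱼ*aⱼᵢ≈1 k l) ⟨
        A k i * A i l * (A k l * A l k)        ≈⟨ solve 4 (λ a b c d → a :* b :* (c :* d) := a :* c :* (b :* d))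
                                                        refl (A k i) (A i l) (A k l) (A l k) ⟩
        A k i * A k l * (A i l * A l k)        ≤⟨ *-monoʳ-≤ (*-pos (positive k i) (positive k l))
                                                    (bⱼ≤bᵢ⇒aᵢⱼaⱼₖ≤aᵢₖ i≢k l≢k (maximal l l≢k)) ⟩
        A k i * A k l * A i k                  ≈⟨ solve 3 (λ a b c → a :* b :* c := a :* c :* b)
                                                        refl (A k i) (A k l) (A i k) ⟩
        A k i * A i k * A k l                  ≈⟨ *-congʳ (aᵢⱼ*aⱼᵢ≈1 k i) ⟩
        1# * A k l                             ≈⟨ *-identityˡ _ ⟩
        A k l                                  ∎

      -- Equality is pulled back along `b` too, so distinct indices may tie. Finiteness then gives
      -- induction in both directions.
      b-isStrictPartialOrder : IsStrictPartialOrder (_≈_ on b) (_<_ on b)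
      b-isStrictPartialOrder = On.isStrictPartialOrder b isStrictPartialOrder

  -- Comparing the quotients of two positive vectors.

  module _ {n} {v w : Vector Carrier n} where

    -- vᵢ / wᵢ ≤ vⱼ / wⱼ, cleared of denominators.
    infix 4 _≼_

    _≼_ : Fin n → Fin n → Set ℓ₂
    i ≼ j = v i * w j ≤ v j * w i

    ≼-trans : Positive w → ∀ {i j l} → i ≼ j → j ≼ l → i ≼ l
    ≼-trans w>0 {i} {j} {l} i≼j j≼l = *-cancelˡ-≤ (w>0 j) (begin
      w j * (v i * w l)  ≈⟨ rearrange (w j) (v i) (w l) ⟩
      w l * (v i * w j)  ≤⟨ *-monoʳ-≤ (w>0 l) i≼j ⟩
      w l * (v j * w i)  ≈⟨ rearrange (w l) (v j) (w i) ⟩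
      w i * (v j * w l)  ≤⟨ *-monoʳ-≤ (w>0 i) j≼l ⟩
      w i * (v l * w j)  ≈⟨ rearrange (w i) (v l) (w j) ⟩
      w j * (v l * w i)  ∎)
      where
      rearrange : ∀ x y z → x * (y * z) ≈ z * (y * x)
      rearrange = solve 3 (λ x y z → x :* (y :* z) := z :* (y :* x)) refl

    ratio-≤⇒≼ : (v>0 : Positive v) (w>0 : Positive w) → ∀ {i j} →
                ratios v v>0 i j ≤ ratios w w>0 i j → i ≼ j
    ratio-≤⇒≼ v>0 w>0 {i} {j} vᵢ/vⱼ≤wᵢ/wⱼ = begin
      v i * w j                                  ≈⟨ *-identityʳ _ ⟨
      v i * w j * 1#                             ≈⟨ *-congˡ (recip-inverse (v j) (v>0 j)) ⟨
      v i * w j * (v j * recip (v j) (v>0 j))    ≈⟨ solve 4 (λ a b c d → a :* b :* (c :* d) := c :* b :* (a :* d))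
                                                          refl (v i) (w j) (v j) (recip (v j) (v>0 j)) ⟩
      v j * w j * ratios v v>0 i j               ≤⟨ *-monoʳ-≤ (*-pos (v>0 j) (w>0 j)) vᵢ/vⱼ≤wᵢ/wⱼ ⟩
      v j * w j * (w i * recip (w j) (w>0 j))    ≈⟨ solve 4 (λ a b c d → a :* b :* (c :* d) := a :* c :* (b :* d))
                                                          refl (v j) (w j) (w i) (recip (w j) (w>0 j)) ⟩
      v j * w i * (w j * recip (w j) (w>0 j))    ≈⟨ *-congˡ (recip-inverse (w j) (w>0 j)) ⟩
      v j * w i * 1#                             ≈⟨ *-identityʳ _ ⟩
      v j * w i                                  ∎

    ≼⇒∝ : Positive w → ∀ k → (∀ i → i ≼ k) → (∀ i → k ≼ i) → v ∝ w
    ≼⇒∝ w>0 k i≼k k≼i = v k * recip (w k) (w>0 k) , λ i → begin-equality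
      v i                                    ≈⟨ *-identityʳ _ ⟨
      v i * 1#                               ≈⟨ *-congˡ (recip-inverse (w k) (w>0 k)) ⟨
      v i * (w k * recip (w k) (w>0 k))      ≈⟨ *-assoc _ _ _ ⟨
      v i * w k * recip (w k) (w>0 k)        ≈⟨ *-congʳ (≤-antisym (i≼k i) (k≼i i)) ⟩
      v k * w i * recip (w k) (w>0 k)        ≈⟨ solve 3 (λ a b c → a :* b :* c := a :* c :* b)
                                                      refl (v k) (w i) (recip (w k) (w>0 k)) ⟩
      v k * recip (w k) (w>0 k) * w i        ∎

  aᵢⱼwⱼ≤wᵢ⇒aᵢⱼ≤wᵢ/wⱼ : ∀ {n} {w : Vector Carrier n} (w>0 : Positive w) {a i j} →
                        a * w j ≤ w i → a ≤ ratios w w>0 i j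
  aᵢⱼwⱼ≤wᵢ⇒aᵢⱼ≤wᵢ/wⱼ {w = w} w>0 {a} {i} {j} awⱼ≤wᵢ = *-cancelˡ-≤ (w>0 j) (begin
    w j * a                                ≈⟨ *-comm _ _ ⟩
    a * w j                                ≤⟨ awⱼ≤wᵢ ⟩
    w i                                    ≈⟨ *-identityʳ _ ⟨
    w i * 1#                               ≈⟨ *-congˡ (recip-inverse (w j) (w>0 j)) ⟨
    w i * (w j * recip (w j) (w>0 j))      ≈⟨ solve 3 (λ a b c → a :* (b :* c) := b :* (a :* c))
                                                    refl (w i) (w j) (recip (w j) (w>0 j)) ⟩
    w j * ratios w w>0 i j                 ∎)

-- Efficiency by induction along the order of `b`.

theorem13 : {c ℓ₁ ℓ₂ : Level} (ℝ : RealNumbers c ℓ₁ ℓ₂) →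
    let open PairwiseComparison ℝ in
    (n : ℕ) (A : Matrix n) → A ∈ 𝒫𝒞 n → IsColumnPerturbedConsistent A → 𝒞 A ⊆ ℰ A
theorem13 ℝ n A A∈𝒫𝒞 (k , consistent) {w} (w#0 , x , 0≤x , w≈) = w>0 , efficient
  where
  open RealNumbers ℝ
  open PairwiseComparison ℝ
  open OrderedField ℝ using (<⇒≤; ≤-reflexive; ∣a-q∣≤∣a-p∣⇒q≤p)
  open ReciprocalMatrix ℝ

  w>0 : Positive w
  w>0 = cone-positive A∈𝒫𝒞 0≤x w≈ w#0

  efficient : ∀ v (v>0 : Positive v) →
    (∀ i j → ∣ A i j - ratios v v>0 i j ∣ ≤ ∣ A i j - ratios w w>0 i j ∣) → v ∝ w
  efficient v v>0 closer = ≼⇒∝ w>0 k i≼k k≼i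
    where
    infix 4 _⊑_

    _⊑_ : Fin n → Fin n → Set _
    _⊑_ = _≼_ {v = v} {w}

    ⊑-trans : ∀ {i j l} → i ⊑ j → j ⊑ l → i ⊑ l
    ⊑-trans {i} {j} {l} = ≼-trans {v = v} {w} w>0 {i} {j} {l}

    -- An arc puts `A i j` below the ratio of `w`, so a ratio of `v` at least as close to `A i j`
    -- cannot be larger.
    ⟶⇒⊑ : ∀ {i j} → _⟶_ A∈𝒫𝒞 i j → i ⊑ j
    ⟶⇒⊑ {i} {j} i⟶j = ratio-≤⇒≼ v>0 w>0 (∣a-q∣≤∣a-p∣⇒q≤p
      (aᵢⱼwⱼ≤wᵢ⇒aᵢⱼ≤wᵢ/wⱼ w>0 (⟶⇒aᵢⱼwⱼ≤wᵢ A∈𝒫𝒞 0≤x w≈ i⟶j)) (closer i j))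

    -- `p` is a parameter because no index other than `k` exists when `n` is 1.
    module _ {p} (p≢k : p ≢ k) where
      _⊏_ : Fin n → Fin n → Set _
      _⊏_ = _<_ on b A∈𝒫𝒞 consistent p≢k

      -- `k<i` is the assumption that `i ⊑ k` fails. Any `l` below `i` would give `i ⊑ l` by an arc
      -- and `l ⊑ k` by induction, contradicting it. So `i` is minimal and has an arc to `k`.
      descend : ∀ {i} → Acc _⊏_ i → i ≢ k → i ⊑ k
      descend {i} (acc rec) i≢k k<i = ⟶⇒⊑ (minimum⟶k A∈𝒫𝒞 consistent p≢k i≢k
        λ l l≢k l⊏i → ⊑-trans {i} {l} {k}
          (⟶⇒⊑ (bⱼ≤bᵢ⇒i⟶j A∈𝒫𝒞 consistent p≢k i≢k l≢k (<⇒≤ l⊏i)))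
          (descend (rec l⊏i) l≢k) k<i) k<i

      -- The mirror image: an `l` above `i` would give `k ⊑ l` by induction and `l ⊑ i` by an arc,
      -- so under the negated goal `i` is maximal.
      ascend : ∀ {i} → Acc (flip _⊏_) i → i ≢ k → k ⊑ i
      ascend {i} (acc rec) i≢k i<k = ⟶⇒⊑ (k⟶maximum A∈𝒫𝒞 consistent p≢k i≢k
        λ l l≢k i⊏l → ⊑-trans {k} {l} {i} (ascend (rec i⊏l) l≢k)
          (⟶⇒⊑ (bⱼ≤bᵢ⇒i⟶j A∈𝒫𝒞 consistent p≢k l≢k i≢k (<⇒≤ i⊏l))) i<k) i<k

    i≼k : ∀ i → i ⊑ k
    i≼k i with i ≟ k
    ... | yes ≡-refl = ≤-reflexive refl
    -- The index `i` itself serves as the normalising `p`.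
    ... | no  i≢k    = descend i≢k
      (spo-wellFounded (b-isStrictPartialOrder A∈𝒫𝒞 consistent i≢k) i) i≢k

    k≼i : ∀ i → k ⊑ i
    k≼i i with i ≟ k
    ... | yes ≡-refl = ≤-reflexive refl
    ... | no  i≢k    = ascend i≢k
      (spo-noetherian (b-isStrictPartialOrder A∈𝒫𝒞 consistent i≢k) i) i≢k
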